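{- Let $F$ be a Ferrers board and let $\tau \in \{231, 312\}$. Then a placement $P \in S_F(\tau)$ is determined by $F$ and the sequence $S(P,F)$; that is, if $P, Q \in S_F(\tau)$ and $S(P,F) = S(Q,F)$, then $P = Q$.
   Context: Let $\mathcal{A}$ be an $m\times m$ array of unit squares in the $xy$-plane with its bottom left corner at the origin. The corners of squares are called vertices. For a vertex $V=(a,b)$, $R(V)$ denotes the rectangular array of squares bounded by the lines $x=0$, $x=a$, $y=0$, $y=b$ (empty if $a=0$ or $b=0$). A Ferrers board is a subset $F$ of $\mathcal{A}$ (for some $m$) such that $R(V)\subseteq F$ for each vertex $V$ of $F$ (a vertex of $F$ is a corner of a square of $F$). So $F$ is left- and bottom-justified. The right/up border of $F$ is the border of $F$ excluding the vertical left-hand side and the horizontal bottom side: it is the lattice path of unit rightward and downward steps along the boundary of $F$ from the top left corner $(0,h)$ of $F$ to the bottom right corner $(w,0)$, where $h$ is the length of the longest column and $w$ that of the longest row; both endpoints are vertices of the right/up border. A rook placement on $F$ is a subset of the squares of $F$ (the squares containing "markers") with at most one square in each row and at most one in each column of $F$; a full rook placement has exactly one marker in each row and each column of $F$. A rook placement $P$ on $F$ avoids a pattern $\tau$ if for every vertex $V$ on the right/up border of $F$ the permutation order-isomorphic to the restriction of $P$ to $R(V)$ (markers read left to right, by height) avoids $\tau$ in the usual sense (has no subsequence order-isomorphic to $\tau$). $S_F(\tau)$ is the set of all full rook placements on $F$ that avoid $\tau$. For a rook placement $P$ on $F$ and a vertex $V$ of $F$, $S(P,V)$ is the maximal length of an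 increasing sequence of markers of $P$ in $R(V)$ (each successive marker strictly to the right of and strictly above the previous one); it is $0$ if $R(V)$ contains no marker. For a full rook placement $P$, $S(P,F)$ denotes the sequence of values $S(P,V)$ for all vertices $V$ on the right/up border of $F$, in order, starting with the top left corner of $F$. -}

module Defs where

open import Data.Fin.Base as Fin using (Fin; toℕ; cast)
open import Data.Fin.Properties as Fin using (any?; all?; toℕ<n)
open import Data.Fin.Subset as Subset using (Subset)
open import Data.Fin.Subset.Properties as Subset using ()
open import Data.List.Base
  using (List; []; _∷_; length; map; filter; lookup; allFin; upTo; downFrom;
         cartesianProduct)
open import Data.List.Relation.Binary.Sublist.Propositional using (_⊆_)
open import Data.List.Relation.Unary.All using (All; []; _∷_)
open import Data.List.Relation.Unary.Linked using (Linked; []; [-]; _∷_)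
open import Data.Nat.Base using (ℕ; zero; suc; _+_; _≤_; _<_; z≤n; s≤s)
open import Data.Nat.Properties as ℕ using (_≟_; _<?_)
open import Data.Product.Base using (Σ; ∃; _×_; _,_; proj₁; proj₂; uncurry)
open import Data.Product using (∃!)
open import Data.Product.Properties using (≡-dec)
open import Data.Sum.Base using (_⊎_)
open import Data.Vec.Base as Vec using (Vec)
open import Function.Base using (_∘_)
open import Function.Bundles using (_⇔_)
open import Relation.Binary.Definitions using (Decidable; DecidableEquality)
open import Relation.Binary.PropositionalEquality using (_≡_; _≢_; refl)
open import Relation.Nullary.Decidable
  using (Dec; yes; no; map′; ¬?; _×-dec_; _⊎-dec_; _→-dec_)
open import Relation.Nullary.Negation using (¬_)
open import Relation.Unary as Unary using ()

private
  variable
    m : ℕ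

-- (i , j) is the unit square with bottom left corner at the point (i , j):
-- it lies in column i (from the left) and row j (from the bottom).
Square : ℕ → Set
Square m = Fin m × Fin m

-- A subset of the m × m array, stored as its columns from left to right.
Squares : ℕ → Set
Squares m = Vec (Subset m) m

infix 4 _∈_ _∈?_ _∈R_ _∈R?_ _↗_ _↗?_ _endpointOf_ _endpointOf?_

_∈_ : Square m → Squares m → Set
(i , j) ∈ X = j Subset.∈ Vec.lookup X i

_∈?_ : (s : Square m) (X : Squares m) → Dec (s ∈ X)
(i , j) ∈? X = j Subset.∈? Vec.lookup X i

anySquare? : {A : Square m → Set} → Unary.Decidable A → Dec (∃ A)
anySquare? A? = map′ (λ (i , j , a) → (i , j) , a) (λ ((i , j) , a) → i , j , a)
                     (any? λ i → any? λ j → A? (i , j))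

allSquares? : {A : Square m → Set} → Unary.Decidable A → Dec (∀ s → A s)
allSquares? A? = map′ uncurry (λ f i j → f (i , j)) (all? λ i → all? λ j → A? (i , j))

------------------------------------------------------------------------
-- Ferrers boards

Vertex : Set
Vertex = ℕ × ℕ

_≟ᵛ_ : DecidableEquality Vertex
_≟ᵛ_ = ≡-dec _≟_ _≟_

CornerOf : Square m → Vertex → Set
CornerOf (i , j) (a , b) =
  (a ≡ toℕ i ⊎ a ≡ suc (toℕ i)) × (b ≡ toℕ j ⊎ b ≡ suc (toℕ j))

IsVertexOf : Squares m → Vertex → Set
IsVertexOf F V = ∃ λ s → s ∈ F × CornerOf s V

-- s ∈R V means that s is one of the squares of the rectangle R(V).
_∈R_ : Square m → Vertex → Set
(i , j) ∈R (a , b) = toℕ i < a × toℕ j < b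

_∈R?_ : (s : Square m) (V : Vertex) → Dec (s ∈R V)
(i , j) ∈R? (a , b) = toℕ i <? a ×-dec toℕ j <? b

record FerrersBoard (m : ℕ) : Set where
  field
    squares   : Squares m
    isFerrers : ∀ V → IsVertexOf squares V → ∀ s → s ∈R V → s ∈ squares

------------------------------------------------------------------------
-- The right/up border

Edge : Set
Edge = Vertex × Vertex

leftSide rightSide bottomSide topSide : Square m → Edge
leftSide   (i , j) = (toℕ i , toℕ j)       , (toℕ i , suc (toℕ j))
rightSide  (i , j) = (suc (toℕ i) , toℕ j) , (suc (toℕ i) , suc (toℕ j))
bottomSide (i , j) = (toℕ i , toℕ j)       , (suc (toℕ i) , toℕ j)
topSide    (i , j) = (toℕ i , suc (toℕ j)) , (suc (toℕ i) , suc (toℕ j))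

_endpointOf_ : Vertex → Edge → Set
V endpointOf e = V ≡ proj₁ e ⊎ V ≡ proj₂ e

_endpointOf?_ : Decidable _endpointOf_
V endpointOf? e = V ≟ᵛ proj₁ e ⊎-dec V ≟ᵛ proj₂ e

-- A side of a square of F is on the border of F when no square of F lies on
-- the other side of it.
RightSideOnBorder TopSideOnBorder : Squares m → Square m → Set
RightSideOnBorder F s = ∀ t → t ∈ F → leftSide t ≢ rightSide s
TopSideOnBorder   F s = ∀ t → t ∈ F → bottomSide t ≢ topSide s

-- The border edges that are right or top sides of squares of F make up the
-- right/up border: for a Ferrers board, the border edges that are left or
-- bottom sides of squares of F all lie on x = 0 or y = 0.
OnRightUpBorder : Squares m → Vertex → Set
OnRightUpBorder F V = ∃ λ s → s ∈ F ×
  ( RightSideOnBorder F s × V endpointOf rightSide s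
  ⊎ TopSideOnBorder   F s × V endpointOf topSide s )

onRightUpBorder? : (F : Squares m) → Unary.Decidable (OnRightUpBorder F)
onRightUpBorder? F V = anySquare? λ s → s ∈? F ×-dec
  ( (allSquares? (λ t → t ∈? F →-dec ¬? (leftSide t ≟ᵉ rightSide s))
       ×-dec V endpointOf? rightSide s)
  ⊎-dec
    (allSquares? (λ t → t ∈? F →-dec ¬? (bottomSide t ≟ᵉ topSide s))
       ×-dec V endpointOf? topSide s) )
  where
  _≟ᵉ_ : DecidableEquality Edge
  _≟ᵉ_ = ≡-dec _≟ᵛ_ _≟ᵛ_

-- The border path has only rightward and downward steps, so it visits its
-- vertices by increasing abscissa and, for equal abscissae, by decreasing
-- ordinate; this is the order of the enumeration below.
rightUpBorder : Squares m → List Vertex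
rightUpBorder {m} F =
  filter (onRightUpBorder? F) (cartesianProduct (upTo (suc m)) (downFrom (suc m)))

------------------------------------------------------------------------
-- Rook placements

-- The columns and rows of F are those that contain a square of F.
record IsFullRookPlacement (F P : Squares m) : Set where
  field
    inBoard         : ∀ s → s ∈ P → s ∈ F
    oneInEachColumn : ∀ i → (∃ λ j → (i , j) ∈ F) → ∃! _≡_ λ j → (i , j) ∈ P
    oneInEachRow    : ∀ j → (∃ λ i → (i , j) ∈ F) → ∃! _≡_ λ i → (i , j) ∈ P

------------------------------------------------------------------------
-- Pattern avoidance

-- Permutations are written in one-line notation, with values from 1.
OrderIsomorphic : List ℕ → List ℕ → Set
OrderIsomorphic xs ys = Σ (length xs ≡ length ys) λ eq → ∀ k l →
  lookup xs k < lookup xs l ⇔ lookup ys (cast eq k) < lookup ys (cast eq l)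

Contains : List ℕ → List ℕ → Set
Contains σ τ = ∃ λ ρ → ρ ⊆ σ × OrderIsomorphic ρ τ

-- Each entry is replaced by its rank; for a word with distinct entries this
-- is the permutation order-isomorphic to it.
standardize : List ℕ → List ℕ
standardize xs = map (λ x → suc (length (filter (_<? x) xs))) xs

-- The enumeration of squares is column by column, from left to right.
markersIn : Squares m → Vertex → List (Square m)
markersIn {m} P V =
  filter (λ s → s ∈? P ×-dec s ∈R? V) (cartesianProduct (allFin m) (allFin m))

restriction : Squares m → Vertex → List ℕ
restriction P V = standardize (map (toℕ ∘ proj₂) (markersIn P V))

AvoidsOn : Squares m → List ℕ → Squares m → Set
AvoidsOn F τ P = ∀ V → OnRightUpBorder F V → ¬ Contains (restriction P V) τ

-- P ∈ S_F(τ)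
record FullAvoiding (F : FerrersBoard m) (τ : List ℕ) (P : Squares m) : Set where
  open FerrersBoard F
  field
    isFull : IsFullRookPlacement squares P
    avoids : AvoidsOn squares τ P

------------------------------------------------------------------------
-- Longest increasing sequences of markers

_↗_ : Square m → Square m → Set
(i , j) ↗ (i′ , j′) = i Fin.< i′ × j Fin.< j′

_↗?_ : Decidable (_↗_ {m})
(i , j) ↗? (i′ , j′) = i Fin.<? i′ ×-dec j Fin.<? j′

IsIncreasingSequence : Squares m → Vertex → List (Square m) → Set
IsIncreasingSequence P V c = Linked _↗_ c × All (λ s → s ∈ P × s ∈R V) c

IsMaximalLength : Squares m → Vertex → ℕ → Set
IsMaximalLength P V n =
  (∃ λ c → IsIncreasingSequence P V c × length c ≡ n) ×
  (∀ c → IsIncreasingSequence P V c → length c ≤ n)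

private
  module _ (P : Squares m) (V : Vertex) where

    Increasing : List (Square m) → Set
    Increasing = IsIncreasingSequence P V

    startingAt? : ∀ n s → Dec (∃ λ c → Increasing (s ∷ c) × length c ≡ n)
    startingAt? zero s = map′
      (λ p → [] , ([-] , p ∷ []) , refl)
      (λ { (_ , (_ , p ∷ _) , _) → p })
      (s ∈? P ×-dec s ∈R? V)
    startingAt? (suc n) s = map′
      (λ { ((p , t , s↗t , c , (l , ps) , refl)) →
             t ∷ c , (s↗t ∷ l , p ∷ ps) , refl })
      (λ { (t ∷ c , (s↗t ∷ l , p ∷ ps) , refl) →
             p , t , s↗t , c , (l , ps) , refl })
      ((s ∈? P ×-dec s ∈R? V) ×-dec
        anySquare? λ t → s ↗? t ×-dec startingAt? n t)

    ofLength? : ∀ n → Dec (∃ λ c → Increasing c × length c ≡ n)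
    ofLength? zero    = yes ([] , ([] , []) , refl)
    ofLength? (suc n) = map′
      (λ { (s , c , inc , refl) → s ∷ c , inc , refl })
      (λ { (s ∷ c , inc , refl) → s , c , inc , refl })
      (anySquare? (startingAt? n))

    column+length≤m : ∀ s c → Linked _↗_ (s ∷ c) → toℕ (proj₁ s) + suc (length c) ≤ m
    column+length≤m s []      _ = begin
      toℕ (proj₁ s) + 1  ≡⟨ ℕ.+-comm (toℕ (proj₁ s)) 1 ⟩
      suc (toℕ (proj₁ s)) ≤⟨ toℕ<n (proj₁ s) ⟩
      m                  ∎
      where open ℕ.≤-Reasoning
    column+length≤m s (t ∷ c) ((i<i′ , _) ∷ l) = begin
      toℕ (proj₁ s) + suc (suc (length c)) ≡⟨ ℕ.+-suc (toℕ (proj₁ s)) _ ⟩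
      suc (toℕ (proj₁ s)) + suc (length c) ≤⟨ ℕ.+-monoˡ-≤ (suc (length c)) i<i′ ⟩
      toℕ (proj₁ t) + suc (length c)       ≤⟨ column+length≤m t c l ⟩
      m                                    ∎
      where open ℕ.≤-Reasoning

    length≤m : ∀ c → Increasing c → length c ≤ m
    length≤m []      _       = z≤n
    length≤m (s ∷ c) (l , _) = ℕ.m+n≤o⇒n≤o (toℕ (proj₁ s)) (column+length≤m s c l)

    search : ∀ k → (∀ c → Increasing c → length c ≤ k) → ∃ (IsMaximalLength P V)
    search zero    bound = zero , ([] , ([] , []) , refl) , bound
    search (suc k) bound with ofLength? (suc k)
    ... | yes found = suc k , found , bound
    ... | no  none  = search k λ c inc →
      ℕ.≤-pred (ℕ.≤∧≢⇒< (bound c inc) λ eq → none (c , inc , eq))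

maximalLength : (P : Squares m) (V : Vertex) → ∃ (IsMaximalLength P V)
maximalLength {m} P V = search P V m (length≤m P V)

-- S(P,V)
S : Squares m → Vertex → ℕ
S P V = proj₁ (maximalLength P V)

-- S(P,F)
Sequence : FerrersBoard m → Squares m → List ℕ
Sequence F P = map (S P) (rightUpBorder (FerrersBoard.squares F))

{-# OPTIONS --safe #-}

-- Take τ = 231 and sweep the columns from right to left, knowing the placement
-- from column c + 1 on and the values S(P , (c + 1 , b)) for all b up to the
-- height t of column c.  Because of the avoidance, an increasing sequence in
-- R(c + 1 , t) has at most one marker above the marker of column c, and that
-- one can be exchanged for the marker of column c.  So the marker of column c
-- is in the lowest row r for which R(c + 1 , r + 1) attains the value
-- S(P , (c + 1 , t)).  The values S(P , (c , b)) are unchanged for b ≤ r.  For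
-- b > r + 1 they follow from the border value S(P , (c , t)), which is already
-- attained as soon as R(c , b) has a marker above row r; fullness and the known
-- columns tell when that happens.  The case 312 is the reflection in x = y.

module Submission where

open import Defs
open import Data.Fin.Base as Fin using (Fin; toℕ; fromℕ<)
open import Data.Fin.Patterns using (0F; 1F; 2F)
open import Data.Fin.Properties as Fin using (toℕ-injective; toℕ-fromℕ<; toℕ<n)
open import Data.Fin.Subset.Properties using (⊆-antisym)
open import Data.List.Base using (List; []; _∷_; length; map; filter; cartesianProduct)
import Data.List.Membership.Propositional as List
open import Data.List.Membership.Propositional.Properties
  using (∈-filter⁺; ∈-cartesianProduct⁺; ∈-upTo⁺; ∈-downFrom⁺; ∈-allFin; ∈-map⁺)
open import Data.List.Properties using (filter-all; ∷-injective)
open import Data.List.Relation.Binary.Sublist.Propositional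
  using (_⊆_; []; _∷_; _∷ʳ_; ⊆-refl; from∈; lookup)
open import Data.List.Relation.Binary.Sublist.Propositional.Properties as Sublist
  using (++⁺; ++⁺ˡ)
open import Data.List.Relation.Unary.All as All using (All; []; _∷_)
open import Data.List.Relation.Unary.AllPairs using (AllPairs; []; _∷_)
open import Data.List.Relation.Unary.AllPairs.Properties using (tabulate⁺-<)
open import Data.List.Relation.Unary.Any using (here; there)
open import Data.List.Relation.Unary.Linked using (Linked; []; [-]; _∷_)
open import Data.Nat.Base using (ℕ; zero; suc; _+_; _≤_; _<_; z≤n; s≤s; s≤s⁻¹)
open import Data.Nat.Properties
open import Data.Product.Base using (∃; _×_; _,_; proj₁; proj₂; swap)
open import Data.Sum.Base using (_⊎_; inj₁; inj₂)
open import Data.Vec.Base as Vec using ()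
open import Data.Vec.Properties using (tabulate∘lookup; tabulate-cong)
open import Function.Base using (_∘_; id; flip)
open import Function.Bundles using (_⇔_; mk⇔)
open import Level using (0ℓ)
open import Relation.Binary.Core using (Rel; _⇒_)
open import Relation.Binary.Definitions using (Decidable; tri<; tri≈; tri>)
open import Relation.Binary.PropositionalEquality
open import Relation.Nullary.Decidable using (Dec; yes; no; map′; _×-dec_)
open import Relation.Nullary.Negation using (¬_; contradiction)
open import Relation.Unary as Unary using ()

-- Boards, placements and increasing sequences over the natural numbers

Cells : Set₁
Cells = Rel ℕ 0ℓ

private
  variable
    F P Q : Cells
    m a b a′ b′ n k : ℕ

-- An increasing sequence of n markers in R(a , b) whose last marker is the one of
-- the outermost snoc; the remaining markers then lie in R(i , j).
data Chain (P : Cells) (a b : ℕ) : ℕ → Set where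
  []   : Chain P a b zero
  snoc : ∀ {i j} → P i j → i < a → j < b → Chain P i j n → Chain P a b (suc n)

widen : a ≤ a′ → b ≤ b′ → Chain P a b n → Chain P a′ b′ n
widen a≤ b≤ []                = []
widen a≤ b≤ (snoc p i<a j<b c) = snoc p (<-≤-trans i<a a≤) (<-≤-trans j<b b≤) c

shorten : k ≤ n → Chain P a b n → Chain P a b k
shorten z≤n       c                  = []
shorten (s≤s k≤n) (snoc p i<a j<b c) = snoc p i<a j<b (shorten k≤n c)

chain-length≤ : Chain P a b n → n ≤ a
chain-length≤ []               = z≤n
chain-length≤ (snoc p i<a _ c) = ≤-trans (s≤s (chain-length≤ c)) i<a

transposeChain : Chain P a b n → Chain (flip P) b a n
transposeChain []                 = []
transposeChain (snoc p i<a j<b c) = snoc p j<b i<a (transposeChain c)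

-- Chains can be shortened, so this compares the maximal lengths in R(a , b) without mentioning a
-- maximum.
_≲[_,_]_ : Cells → ℕ → ℕ → Cells → Set
P ≲[ a , b ] Q = ∀ {n} → Chain P a b n → Chain Q a b n

_≈[_,_]_ : Cells → ℕ → ℕ → Cells → Set
P ≈[ a , b ] Q = P ≲[ a , b ] Q × Q ≲[ a , b ] P

≈-zero : P ≈[ a , zero ] Q
≈-zero = (λ { [] → [] ; (snoc _ _ () _) }) , (λ { [] → [] ; (snoc _ _ () _) })

record IsBoard (m : ℕ) (F : Cells) : Set where
  field
    F?         : Decidable F
    downClosed : F a b → a′ ≤ a → b′ ≤ b → F a′ b′
    column<    : F a b → a < m
    row<       : F a b → b < m

record IsFullPlacement (F P : Cells) : Set where
  field
    inBoard      : P ⇒ F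
    column       : F a b → ∃ λ j → P a j
    row          : F a b → ∃ λ i → P i b
    columnUnique : P a b → P a b′ → b ≡ b′
    rowUnique    : P a b → P a′ b → a ≡ a′

-- On a Ferrers board three markers lie in R(V) for some border vertex V exactly when the square in
-- the last of their columns and the highest of their rows is in F.
Avoids231 Avoids312 : Cells → Cells → Set
Avoids231 F P = ∀ {i j i′ j′ i″ j″} → P i j → P i′ j′ → P i″ j″ →
  i < i′ → i′ < i″ → j″ < j → j < j′ → ¬ F i″ j′
Avoids312 F P = ∀ {i j i′ j′ i″ j″} → P i j → P i′ j′ → P i″ j″ →
  i < i′ → i′ < i″ → j′ < j″ → j″ < j → ¬ F i″ j

record SameOnBorder (F P Q : Cells) : Set where
  field
    right : F a b → ¬ F (suc a) b → P ≈[ suc a , b ] Q × P ≈[ suc a , suc b ] Q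
    top   : F a b → ¬ F a (suc b) → P ≈[ a , suc b ] Q × P ≈[ suc a , suc b ] Q

-- Reflection in the diagonal

transposeBoard : IsBoard m F → IsBoard m (flip F)
transposeBoard board = record
  { F?         = flip F?
  ; downClosed = λ f a≤ b≤ → downClosed f b≤ a≤
  ; column<    = row<
  ; row<       = column<
  }
  where open IsBoard board

transposePlacement : IsFullPlacement F P → IsFullPlacement (flip F) (flip P)
transposePlacement full = record
  { inBoard      = inBoard
  ; column       = row
  ; row          = column
  ; columnUnique = rowUnique
  ; rowUnique    = columnUnique
  }
  where open IsFullPlacement full

transpose≈ : P ≈[ a , b ] Q → flip P ≈[ b , a ] flip Q
transpose≈ (to , from) =
  (λ c → transposeChain (to (transposeChain c))) ,
  (λ c → transposeChain (from (transposeChain c)))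

transposeSame : SameOnBorder F P Q → SameOnBorder (flip F) (flip P) (flip Q)
transposeSame same = record
  { right = λ f ¬f → let e , e′ = top f ¬f in transpose≈ e , transpose≈ e′
  ; top   = λ f ¬f → let e , e′ = right f ¬f in transpose≈ e , transpose≈ e′
  }
  where open SameOnBorder same

-- Column tops and the exchange of markers

topOfColumn : IsBoard m F → F a b → ∃ λ t → b ≤ t × F a t × ¬ F a (suc t)
topOfColumn {m = m} {F} {a} {b} board f = climb m f ≤-refl (m≤n+m m b)
  where
  open IsBoard board
  climb : ∀ fuel {t} → F a t → b ≤ t → m ≤ t + fuel →
          ∃ λ t → b ≤ t × F a t × ¬ F a (suc t)
  -- With the fuel spent, the invariant gives m ≤ t, but all rows of the board are below m.
  climb zero {t} f b≤t m≤ =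
    contradiction (row< f) (≤⇒≯ (subst (m ≤_) (+-identityʳ t) m≤))
  climb (suc fuel) {t} f b≤t m≤ with F? a (suc t)
  ... | no ¬f  = t , b≤t , f , ¬f
  ... | yes f′ = climb fuel f′ (m≤n⇒m≤1+n b≤t) (subst (m ≤_) (+-suc t fuel) m≤)

module _ (full : IsFullPlacement F P) (avoids : Avoids231 F P) where
  open IsFullPlacement full

  -- In the columns left of (i , j), a marker above row r would start a 231.
  lowerRest : ∀ {c r i j} → P c r → P i j → i < c → r < j → F c j →
              Chain P i j n → Chain P i r n
  lowerRest pc p i<c r<j f [] = []
  lowerRest {r = r} pc p i<c r<j f (snoc {j = j′} p′ i′<i j′<j ch) with <-cmp j′ r
  ... | tri< j′<r _ _ = snoc p′ i′<i j′<r ch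
  ... | tri≈ _ refl _ = contradiction (rowUnique p′ pc) (<⇒≢ (<-trans i′<i i<c))
  ... | tri> _ _ r<j′ = contradiction f (avoids p′ p pc i′<i i<c r<j′ j′<j)

  -- If the last marker is above row r, `lowerRest` puts the others below row r, and the marker of
  -- column c can take its place.
  lowerChain : ∀ {c r t} → P c r → (∀ {j} → j < t → F c j) →
               Chain P (suc c) t n → Chain P (suc c) (suc r) n
  lowerChain pc fs [] = []
  lowerChain {c = c} {r} pc fs (snoc {i = i} {j} p i≤c j<t ch) with <-cmp j r
  ... | tri< j<r _ _ = snoc p i≤c (m<n⇒m<1+n j<r) ch
  ... | tri≈ _ refl _ = snoc p i≤c ≤-refl ch
  ... | tri> _ _ r<j =
    snoc pc ≤-refl ≤-refl (widen (<⇒≤ i<c) ≤-refl (lowerRest pc p i<c r<j (fs j<t) ch))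
    where
    i<c : i < c
    i<c = ≤∧≢⇒< (s≤s⁻¹ i≤c) λ { refl → <⇒≢ r<j (columnUnique pc p) }

module _ (full : IsFullPlacement F P) where
  open IsFullPlacement full

  dropColumn : ∀ {c r b} → P c r → b ≤ r → Chain P (suc c) b n → Chain P c b n
  dropColumn pc b≤r [] = []
  dropColumn pc b≤r (snoc p i≤c j<b ch) =
    snoc p (≤∧≢⇒< (s≤s⁻¹ i≤c) λ { refl → <⇒≢ (<-≤-trans j<b b≤r) (columnUnique p pc) }) j<b ch

  -- Hence the maximal length strictly grows from R(c + 1 , r) to R(c + 1 , r + 1): no row below r
  -- attains the value of `lowerChain`.
  addMarker : ∀ {c r} → P c r → Chain P (suc c) r n → Chain P (suc c) (suc r) (suc n)
  addMarker pc ch = snoc pc ≤-refl ≤-refl (dropColumn pc ≤-refl ch)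

-- Otherwise every chain of Q could be moved below row r′ by way of P and then
-- extended by the marker of Q in row r′.
marker≮ : ∀ {c r r′ t} → IsFullPlacement F P → Avoids231 F P → IsFullPlacement F Q →
          P c r → Q c r′ → (∀ {j} → j < t → F c j) → r′ < t →
          (∀ {b} → b ≤ t → P ≈[ suc c , b ] Q) → ¬ r < r′
marker≮ {Q = Q} {c = c} {t = t} fullP avP fullQ p q fs r′<t same r<r′ =
  -- A chain in R(c + 1 , t) has at most c + 1 markers, so length c + 2 is absurd.
  1+n≰n (chain-length≤ (unbounded (suc (suc c))))
  where
  unbounded : ∀ n → Chain Q (suc c) t n
  unbounded zero    = []
  unbounded (suc n) = widen ≤-refl r′<t (addMarker fullQ q (widen ≤-refl r<r′
    (proj₁ (same (<-≤-trans r<r′ (<⇒≤ r′<t)))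
      (lowerChain fullP avP p fs (proj₂ (same ≤-refl) (unbounded n))))))

-- Passing from the line x = c + 1 to the line x = c

AgreeFrom : ℕ → Cells → Cells → Set
AgreeFrom c P Q = ∀ {i j} → c ≤ i → P i j → Q i j

extendAgree : ∀ {c} → AgreeFrom (suc c) P Q → (∀ {j} → P c j → Q c j) → AgreeFrom c P Q
extendAgree {c = c} agree column {i} c≤i p with c ≟ i
... | yes refl = column p
... | no c≢i   = agree (≤∧≢⇒< c≤i c≢i) p

-- Chains inside rows ≤ r do not see column c.  A chain of P reaching above row r
-- has a counterpart in Q at height t, the height of column c, and this can be
-- rerouted below b through a marker of Q in a row between r and b.
step≲ : ∀ {c r t} → IsFullPlacement F P → IsFullPlacement F Q → Avoids231 F Q →
        P c r → Q c r → (∀ {j} → j < t → F c j) → r < t →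
        (∀ {b} → b ≤ t → P ≲[ suc c , b ] Q) → P ≲[ c , t ] Q →
        AgreeFrom c Q P →
        ∀ {b} → b ≤ t → P ≲[ c , b ] Q
step≲ {F = F} {P} {Q} {c} {r} {t} fullP fullQ avQ pc qc fs r<t same same-t agree = go
  where
  module P = IsFullPlacement fullP
  module Q = IsFullPlacement fullQ

  low : ∀ {b n} → b ≤ r → Chain P c b n → Chain Q c b n
  low b≤r ch = dropColumn fullQ qc b≤r
    (same (≤-trans b≤r (<⇒≤ r<t)) (widen (n≤1+n _) ≤-refl ch))

  -- As P and Q agree from column c on, the marker of Q in row y is also left of c.
  high : ∀ {b n i y} → b ≤ t → P i y → i < c → r < y → y < b →
         Chain Q c t (suc n) → Chain Q c b (suc n)
  high {b} {n} {i} {y} b≤t p i<c r<y y<b (snoc {i = x} {z} q x<c z<t ch) with z <? b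
  ... | yes z<b = snoc q x<c z<b ch
  ... | no  z≮b with Q.row (P.inBoard p)
  ...   | i′ , q′ = snoc q′ i′<c y<b (widen (<⇒≤ x<i′) (<⇒≤ r<y) rest)
    where
    y<z : y < z
    y<z = <-≤-trans y<b (≮⇒≥ z≮b)
    i′<c : i′ < c
    i′<c = ≰⇒> λ c≤i′ → <⇒≱ i<c (subst (c ≤_) (P.rowUnique (agree c≤i′ q′) p) c≤i′)
    x<i′ : x < i′
    x<i′ with <-cmp x i′
    ... | tri< x<i′ _ _ = x<i′
    ... | tri≈ _ refl _ = contradiction (Q.columnUnique q′ q) (<⇒≢ y<z)
    -- The markers in columns i′, x and c would form a 231, and its corner square (c , z) is in F.
    ... | tri> _ _ i′<x = contradiction (fs z<t) (avQ q′ q qc i′<x x<c r<y y<z)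
    rest : Chain Q x r n
    rest = lowerRest fullQ avQ qc q x<c (<-trans r<y y<z) (fs z<t) ch

  go : ∀ {b} → b ≤ t → P ≲[ c , b ] Q
  go b≤t [] = []
  go {b} b≤t ch@(snoc {j = j} p i<c j<b ch′) with <-cmp j r | b ≤? r
  ... | _             | yes b≤r = low b≤r ch
  -- The last marker is the highest, so the whole chain lies in R(c , r).
  ... | tri< j<r _ _  | no b≰r  = widen ≤-refl (≰⇒≥ b≰r) (low ≤-refl (snoc p i<c j<r ch′))
  ... | tri≈ _ refl _ | _       = contradiction (P.rowUnique p pc) (<⇒≢ i<c)
  ... | tri> _ _ r<j  | no _    = high b≤t p i<c r<j j<b (same-t (widen ≤-refl b≤t ch))

-- The sweep over all columns

module _ {m} (board : IsBoard m F)
         (fullP : IsFullPlacement F P) (avP : Avoids231 F P)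
         (fullQ : IsFullPlacement F Q) (avQ : Avoids231 F Q)
         (border : SameOnBorder F P Q) where
  open IsBoard board
  open SameOnBorder border
  private
    module P = IsFullPlacement fullP
    module Q = IsFullPlacement fullQ

  -- State of the sweep at the line x = c. The heights in `same` reach the top of the column left of
  -- this line; `suc i ≡ c` names that column and leaves nothing to know at c = 0.
  record Known (c : ℕ) : Set where
    field
      agree  : AgreeFrom c P Q
      agree′ : AgreeFrom c Q P
      same   : ∀ {i j} → suc i ≡ c → F i j → P ≈[ c , suc j ] Q

  -- Here the heights reach only the top of column c, which may be lower than the column to its
  -- left.
  record KnownColumn (c : ℕ) : Set where
    field
      to   : ∀ {j} → P c j → Q c j
      from : ∀ {j} → Q c j → P c j
      same : ∀ {j} → F c j → P ≈[ c , suc j ] Q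

  knownColumn : ∀ c → Known (suc c) → KnownColumn c
  knownColumn c known with F? c zero
  ... | no ¬f = record
    { to   = λ p → contradiction (downClosed (P.inBoard p) ≤-refl z≤n) ¬f
    ; from = λ q → contradiction (downClosed (Q.inBoard q) ≤-refl z≤n) ¬f
    ; same = λ f → contradiction (downClosed f ≤-refl z≤n) ¬f
    }
  ... | yes f₀ with topOfColumn board f₀ | P.column f₀ | Q.column f₀
  -- `t` indexes the top row, so column c has height `suc t`; the left end (c , t + 1) of its top
  -- side supplies the border value for `step≲`.
  ...   | t , _ , f , ¬f | r , p | r′ , q = record
    { to   = to
    ; from = from
    ; same = λ f′ → step≲ fullP fullQ avQ p (to p) fs r<t (proj₁ ∘ sames)
                      (proj₁ (proj₁ (top f ¬f))) agree′ (below f′)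
                  , step≲ fullQ fullP avP q (from q) fs r′<t (proj₂ ∘ sames)
                      (proj₂ (proj₁ (top f ¬f))) agree (below f′)
    }
    where
    module K = Known known
    below : ∀ {j} → F c j → j < suc t
    below f′ = ≰⇒> λ t<j → ¬f (downClosed f′ ≤-refl t<j)
    fs : ∀ {j} → j < suc t → F c j
    fs j≤t = downClosed f ≤-refl (s≤s⁻¹ j≤t)
    r<t : r < suc t
    r<t = below (P.inBoard p)
    r′<t : r′ < suc t
    r′<t = below (Q.inBoard q)
    sames : ∀ {b} → b ≤ suc t → P ≈[ suc c , b ] Q
    sames {zero}  _    = ≈-zero
    sames {suc b} b<t = K.same refl (fs b<t)
    r≡r′ : r ≡ r′
    r≡r′ = ≤-antisym
      (≮⇒≥ (marker≮ fullQ avQ fullP q p fs r<t (swap ∘ sames)))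
      (≮⇒≥ (marker≮ fullP avP fullQ p q fs r′<t sames))
    to : ∀ {j} → P c j → Q c j
    to p′ = subst (Q c) (trans (sym r≡r′) (P.columnUnique p p′)) q
    from : ∀ {j} → Q c j → P c j
    from q′ = subst (P c) (trans r≡r′ (Q.columnUnique q q′)) p
    agree : AgreeFrom c P Q
    agree = extendAgree {P = P} {Q} K.agree to
    agree′ : AgreeFrom c Q P
    agree′ = extendAgree {P = Q} {P} K.agree′ from

  known-step : ∀ c → Known (suc c) → Known c
  known-step c known = record
    { agree  = extendAgree {P = P} {Q} K.agree C.to
    ; agree′ = extendAgree {P = Q} {P} K.agree′ C.from
    ; same   = same
    }
    where
    module K = Known known
    module C = KnownColumn (knownColumn c known)
    same : ∀ {i j} → suc i ≡ c → F i j → P ≈[ c , suc j ] Q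
    same {i} {j} refl f with F? c j
    ... | yes f′ = C.same f′
    -- Above the top of column c the line x = c is itself part of the border.
    ... | no ¬f′ = proj₂ (right f ¬f′)

  known-all : ∀ c → Known c → Known zero
  known-all zero    known = known
  known-all (suc c) known = known-all c (known-step c known)

  known-last : Known m
  known-last = record
    { agree  = λ m≤i p → contradiction (column< (P.inBoard p)) (≤⇒≯ m≤i)
    ; agree′ = λ m≤i q → contradiction (column< (Q.inBoard q)) (≤⇒≯ m≤i)
    -- No square lies beyond x = m, so right sides on that line are on the border.
    ; same   = λ { refl f → proj₂ (right f (λ f′ → <-irrefl refl (column< f′))) }
    }

  determined231 : P ⇒ Q
  determined231 = Known.agree (known-all m known-last) z≤n

-- Reflection inverts permutations, and 312 is the inverse of 231: read by rows, the second, third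
-- and first marker of a 312 form a 231.
determined312 : IsBoard m F → IsFullPlacement F P → Avoids312 F P →
                IsFullPlacement F Q → Avoids312 F Q → SameOnBorder F P Q → P ⇒ Q
determined312 board fullP avP fullQ avQ border =
  determined231 (transposeBoard board)
    (transposePlacement fullP) (λ p p′ p″ j<j′ j′<j″ i″<i i<i′ → avP p″ p p′ i″<i i<i′ j<j′ j′<j″)
    (transposePlacement fullQ) (λ p p′ p″ j<j′ j′<j″ i″<i i<i′ → avQ p″ p p′ i″<i i<i′ j<j′ j′<j″)
    (transposeSame border)

-- Sublists, filters and ranks

module _ {A : Set} where
  map-≡⇒≗ : {B : Set} {f g : A → B} {x : A} {xs : List A} →
             map f xs ≡ map g xs → x List.∈ xs → f x ≡ g x
  map-≡⇒≗ eq (here refl) = proj₁ (∷-injective eq)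
  map-≡⇒≗ eq (there x∈)  = map-≡⇒≗ (proj₂ (∷-injective eq)) x∈

  -- Distinct pairs use distinct positions of `xs`, so each is found in its own block
  -- `map (x ,_) ys`, whatever the order of the second components.
  ⊆-cartesianProduct : {B : Set} {xs : List A} {ys : List B} (ps : List (A × B)) →
    map proj₁ ps ⊆ xs → All (λ p → proj₂ p List.∈ ys) ps → ps ⊆ cartesianProduct xs ys
  ⊆-cartesianProduct []       _            _         = Sublist.[]⊆-universal _
  ⊆-cartesianProduct (p ∷ ps) (x ∷ʳ sub)   ∈ys       =
    ++⁺ˡ (map (x ,_) _) (⊆-cartesianProduct (p ∷ ps) sub ∈ys)
  ⊆-cartesianProduct (p ∷ ps) (refl ∷ sub) (y∈ ∷ ∈ys) =
    ++⁺ (from∈ (∈-map⁺ (proj₁ p ,_) y∈)) (⊆-cartesianProduct ps sub ∈ys)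

module _ {A : Set} {B C : A → Set} (B? : Unary.Decidable B) (C? : Unary.Decidable C)
         (B⇒C : ∀ {x} → B x → C x) where

  length-filter-≤ : ∀ xs → length (filter B? xs) ≤ length (filter C? xs)
  length-filter-≤ xs =
    Sublist.length-mono-≤ (Sublist.filter⁺ B? C? (λ { refl → B⇒C }) (⊆-refl {x = xs}))

  length-filter-< : ∀ {x xs} → x List.∈ xs → ¬ B x → C x →
                    length (filter B? xs) < length (filter C? xs)
  length-filter-< {x} {_ ∷ xs} (here refl) ¬b c with B? x | C? x
  ... | yes b | _     = contradiction b ¬b
  ... | no _  | no ¬c = contradiction c ¬c
  ... | no _  | yes _ = s≤s (length-filter-≤ xs)
  length-filter-< {xs = z ∷ _} (there x∈) ¬b c with B? z | C? z
  ... | yes b | no ¬c = contradiction (B⇒C b) ¬c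
  ... | yes _ | yes _ = s≤s (length-filter-< x∈ ¬b c)
  ... | no _  | yes _ = m<n⇒m<1+n (length-filter-< x∈ ¬b c)
  ... | no _  | no _  = length-filter-< x∈ ¬b c

-- The order of the entries is forced, so membership alone suffices.
increasing⇒⊆ : {xs ys : List (Fin m)} → AllPairs Fin._<_ xs → AllPairs Fin._<_ ys →
               All (List._∈ ys) xs → xs ⊆ ys
increasing⇒⊆ []         _            _  = Sublist.[]⊆-universal _
increasing⇒⊆ (x< ∷ inc) (y< ∷ inc′) (here refl ∷ ∈ys) =
  refl ∷ increasing⇒⊆ inc inc′ (All.zipWith later (x< , ∈ys))
  where
  later : ∀ {z} → _ Fin.< z × z List.∈ (_ ∷ _) → z List.∈ _
  later (x<x , here refl) = contradiction refl (Fin.<⇒≢ x<x)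
  later (_   , there z∈)  = z∈
increasing⇒⊆ {ys = y ∷ _} (x< ∷ inc) (y< ∷ inc′) (there x∈ ∷ ∈ys) =
  y ∷ʳ increasing⇒⊆ (x< ∷ inc) inc′ (x∈ ∷ All.zipWith later (x< , ∈ys))
  where
  later : ∀ {z} → _ Fin.< z × z List.∈ (y ∷ _) → z List.∈ _
  later (x<y , here refl) = contradiction (All.lookup y< x∈) (Fin.<-asym x<y)
  later (_   , there z∈)  = z∈

-- The function that `standardize xs` maps over `xs`.
rank : List ℕ → ℕ → ℕ
rank xs x = suc (length (filter (_<? x) xs))

-- Everything below `x` is below `y`, and `x` itself is counted only for `y`.
rank-mono-< : ∀ {x y xs} → x List.∈ xs → x < y → rank xs x < rank xs y
rank-mono-< {x} {y} x∈ x<y = s≤s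
  (length-filter-< (_<? x) (_<? y) (λ z<x → <-trans z<x x<y) x∈ (<-irrefl refl) x<y)

module _ {A B : Set} where
  both : A → B → A ⇔ B
  both a b = mk⇔ (λ _ → b) (λ _ → a)

  neither : ¬ A → ¬ B → A ⇔ B
  neither ¬a ¬b = mk⇔ (λ a → contradiction a ¬a) (λ b → contradiction b ¬b)

-- The patterns 231 and 312 entry by entry

orderIsomorphic231 : ∀ {x y z} → z < x → x < y →
                     OrderIsomorphic (x ∷ y ∷ z ∷ []) (2 ∷ 3 ∷ 1 ∷ [])
orderIsomorphic231 z<x x<y = refl , λ where
  0F 0F → neither (<-irrefl refl) (<-irrefl refl)
  0F 1F → both x<y (n<1+n _)
  0F 2F → neither (<-asym z<x) (<-asym (n<1+n _))
  1F 0F → neither (<-asym x<y) (<-asym (n<1+n _))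
  1F 1F → neither (<-irrefl refl) (<-irrefl refl)
  1F 2F → neither (<-asym (<-trans z<x x<y)) (<-asym (s≤s (s≤s z≤n)))
  2F 0F → both z<x (n<1+n _)
  2F 1F → both (<-trans z<x x<y) (s≤s (s≤s z≤n))
  2F 2F → neither (<-irrefl refl) (<-irrefl refl)

orderIsomorphic312 : ∀ {x y z} → y < z → z < x →
                     OrderIsomorphic (x ∷ y ∷ z ∷ []) (3 ∷ 1 ∷ 2 ∷ [])
orderIsomorphic312 y<z z<x = refl , λ where
  0F 0F → neither (<-irrefl refl) (<-irrefl refl)
  0F 1F → neither (<-asym (<-trans y<z z<x)) (<-asym (s≤s (s≤s z≤n)))
  0F 2F → neither (<-asym z<x) (<-asym (n<1+n _))
  1F 0F → both (<-trans y<z z<x) (s≤s (s≤s z≤n))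
  1F 1F → neither (<-irrefl refl) (<-irrefl refl)
  1F 2F → both y<z (n<1+n _)
  2F 0F → both z<x (n<1+n _)
  2F 1F → neither (<-asym y<z) (<-asym (n<1+n _))
  2F 2F → neither (<-irrefl refl) (<-irrefl refl)

-- Boards and placements of the array as relations on numbers

data On (X : Squares m) (a b : ℕ) : Set where
  on : ∀ i j → toℕ i ≡ a → toℕ j ≡ b → (i , j) ∈ X → On X a b

on⁻ : {X : Squares m} {i j : Fin m} → On X (toℕ i) (toℕ j) → (i , j) ∈ X
on⁻ {X = X} (on i′ j′ i≡ j≡ s) =
  subst₂ (λ i j → (i , j) ∈ X) (toℕ-injective i≡) (toℕ-injective j≡) s

on? : (X : Squares m) → ∀ a b → Dec (On X a b)
on? X a b = map′ (λ { ((i , j) , s , i≡ , j≡) → on i j i≡ j≡ s })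
                 (λ { (on i j i≡ j≡ s) → (i , j) , s , i≡ , j≡ })
                 (anySquare? λ (i , j) → (i , j) ∈? X ×-dec toℕ i ≟ a ×-dec toℕ j ≟ b)

on-injective : {X Y : Squares m} → On X ⇒ On Y → On Y ⇒ On X → X ≡ Y
on-injective {X = X} {Y} X⇒Y Y⇒X = begin
  X                           ≡⟨ tabulate∘lookup X ⟨
  Vec.tabulate (Vec.lookup X) ≡⟨ tabulate-cong columns ⟩
  Vec.tabulate (Vec.lookup Y) ≡⟨ tabulate∘lookup Y ⟩
  Y                           ∎
  where
  open ≡-Reasoning
  columns : ∀ i → Vec.lookup X i ≡ Vec.lookup Y i
  columns i = ⊆-antisym (λ s → on⁻ (X⇒Y (on i _ refl refl s)))
                        (λ s → on⁻ (Y⇒X (on i _ refl refl s)))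

module _ {m} (F : FerrersBoard m) where
  open FerrersBoard F

  isBoard : IsBoard m (On squares)
  isBoard = record
    { F?         = on? squares
    ; downClosed = λ { (on i j refl refl s) a≤ b≤ →
        let a<m = ≤-<-trans a≤ (toℕ<n i); b<m = ≤-<-trans b≤ (toℕ<n j) in
        on (fromℕ< a<m) (fromℕ< b<m) (toℕ-fromℕ< a<m) (toℕ-fromℕ< b<m)
          -- For the upper right corner V of (i , j), R(V) holds all squares weakly left of and
          -- below (i , j).
          (isFerrers (suc (toℕ i) , suc (toℕ j)) ((i , j) , s , inj₂ refl , inj₂ refl) _
            ( s≤s (≤-trans (≤-reflexive (toℕ-fromℕ< a<m)) a≤)
            , s≤s (≤-trans (≤-reflexive (toℕ-fromℕ< b<m)) b≤))) }
    ; column<    = λ { (on i _ refl _ _) → toℕ<n i }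
    ; row<       = λ { (on _ j _ refl _) → toℕ<n j }
    }

  rightBorder : On squares a b → ¬ On squares (suc a) b →
                OnRightUpBorder squares (suc a , b) × OnRightUpBorder squares (suc a , suc b)
  rightBorder (on i j refl refl s) ¬f =
    ((i , j) , s , inj₁ (side , inj₁ refl)) , ((i , j) , s , inj₁ (side , inj₂ refl))
    where
    side : RightSideOnBorder squares (i , j)
    -- Comparing the lower ends of the two sides places the square at (a + 1 , b).
    side (i′ , j′) t eq = ¬f (on i′ j′ (cong (proj₁ ∘ proj₁) eq) (cong (proj₂ ∘ proj₁) eq) t)

  topBorder : On squares a b → ¬ On squares a (suc b) →
              OnRightUpBorder squares (a , suc b) × OnRightUpBorder squares (suc a , suc b)
  topBorder (on i j refl refl s) ¬f =
    ((i , j) , s , inj₂ (side , inj₁ refl)) , ((i , j) , s , inj₂ (side , inj₂ refl))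
    where
    side : TopSideOnBorder squares (i , j)
    side (i′ , j′) t eq = ¬f (on i′ j′ (cong (proj₁ ∘ proj₁) eq) (cong (proj₂ ∘ proj₁) eq) t)

border-bounded : {X : Squares m} → OnRightUpBorder X (a , b) → a < suc m × b < suc m
border-bounded ((i , j) , _ , inj₁ (_ , inj₁ refl)) = s≤s (toℕ<n i) , m<n⇒m<1+n (toℕ<n j)
border-bounded ((i , j) , _ , inj₁ (_ , inj₂ refl)) = s≤s (toℕ<n i) , s≤s (toℕ<n j)
border-bounded ((i , j) , _ , inj₂ (_ , inj₁ refl)) = m<n⇒m<1+n (toℕ<n i) , s≤s (toℕ<n j)
border-bounded ((i , j) , _ , inj₂ (_ , inj₂ refl)) = s≤s (toℕ<n i) , s≤s (toℕ<n j)

isFullPlacement : {F P : Squares m} → IsFullRookPlacement F P → IsFullPlacement (On F) (On P)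
isFullPlacement {F = F} {P} full = record
  { inBoard      = λ { (on i j i≡ j≡ s) → on i j i≡ j≡ (inBoard _ s) }
  ; column       = λ { (on i j i≡ _ s) →
      let j′ , p , _ = oneInEachColumn i (j , s) in toℕ j′ , on i j′ i≡ refl p }
  ; row          = λ { (on i j _ j≡ s) →
      let i′ , p , _ = oneInEachRow j (i , s) in toℕ i′ , on i′ j refl j≡ p }
  ; columnUnique = columnUnique
  ; rowUnique    = rowUnique
  }
  where
  open IsFullRookPlacement full
  columnUnique : ∀ {a b b′} → On P a b → On P a b′ → b ≡ b′
  columnUnique (on i j refl refl s) (on i′ j′ i≡ refl s′) with refl ← toℕ-injective i≡ =
    let _ , _ , unique = oneInEachColumn i (j , inBoard _ s) in
    cong toℕ (trans (sym (unique s)) (unique s′))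
  rowUnique : ∀ {a a′ b} → On P a b → On P a′ b → a ≡ a′
  rowUnique (on i j refl refl s) (on i′ j′ refl j≡ s′) with refl ← toℕ-injective j≡ =
    let _ , _ , unique = oneInEachRow j (i , inBoard _ s) in
    cong toℕ (trans (sym (unique s)) (unique s′))

-- Patterns among the markers of R(V)

module _ (P : Squares m) (V : Vertex) where

  -- Increasing columns make `ss` a sublist of the enumeration of all squares, and the filter of
  -- `markersIn` leaves `ss` unchanged.
  markers⊆ : (ss : List (Square m)) → AllPairs Fin._<_ (map proj₁ ss) →
             All (λ s → s ∈ P × s ∈R V) ss → ss ⊆ markersIn P V
  markers⊆ ss inc in-PV = subst (_⊆ markersIn P V) (filter-all marker? in-PV)
    (Sublist.filter⁺ marker? marker? (λ { refl → id })
      (⊆-cartesianProduct ss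
        (increasing⇒⊆ inc (tabulate⁺-< id) (All.universal ∈-allFin _))
        (All.universal (∈-allFin ∘ proj₂) ss)))
    where
    marker? : ∀ s → _
    marker? s = s ∈? P ×-dec s ∈R? V

  -- The entries of the restriction are ranks; `iso` may use only their monotonicity, so it is
  -- stated for every such map `r`.
  contains : ∀ {τ} (ss : List (Square m)) → AllPairs Fin._<_ (map proj₁ ss) →
             All (λ s → s ∈ P × s ∈R V) ss →
             ((r : ℕ → ℕ) → let js = map (toℕ ∘ proj₂) ss in
               (∀ {x y} → x List.∈ js → x < y → r x < r y) →
               OrderIsomorphic (map r js) τ) →
             Contains (restriction P V) τ
  contains ss inc in-PV iso =
    _ , Sublist.map⁺ _ rows⊆ , iso (rank rows) λ x∈ → rank-mono-< (lookup rows⊆ x∈)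
    where
    rows : List ℕ
    rows = map (toℕ ∘ proj₂) (markersIn P V)
    rows⊆ : map (toℕ ∘ proj₂) ss ⊆ rows
    rows⊆ = Sublist.map⁺ _ (markers⊆ ss inc in-PV)

module _ {m} (F : FerrersBoard m) {P : Squares m} where
  open FerrersBoard F

  avoids231 : AvoidsOn squares (2 ∷ 3 ∷ 1 ∷ []) P → Avoids231 (On squares) (On P)
  avoids231 avoids (on i j refl refl p) (on i′ j′ refl refl p′) (on i″ j″ refl refl p″)
            i<i′ i′<i″ j″<j j<j′ f
    -- The right end of the top side of column i″ is a border vertex whose rectangle contains the
    -- three markers.
    with t , j′≤t , g , ¬g ← topOfColumn (isBoard F) f =
    avoids V (proj₂ (topBorder F g ¬g)) (contains P V
      ((i , j) ∷ (i′ , j′) ∷ (i″ , j″) ∷ [])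
      ((i<i′ ∷ <-trans i<i′ i′<i″ ∷ []) ∷ (i′<i″ ∷ []) ∷ [] ∷ [])
      ((p , m<n⇒m<1+n (<-trans i<i′ i′<i″) , m<n⇒m<1+n (<-≤-trans j<j′ j′≤t))
        ∷ (p′ , m<n⇒m<1+n i′<i″ , s≤s j′≤t)
        ∷ (p″ , ≤-refl , m<n⇒m<1+n (<-≤-trans (<-trans j″<j j<j′) j′≤t)) ∷ [])
      (λ _ mono → orderIsomorphic231 (mono (there (there (here refl))) j″<j)
                                     (mono (here refl) j<j′)))
    where
    V : Vertex
    V = suc (toℕ i″) , suc t

  avoids312 : AvoidsOn squares (3 ∷ 1 ∷ 2 ∷ []) P → Avoids312 (On squares) (On P)
  avoids312 avoids (on i j refl refl p) (on i′ j′ refl refl p′) (on i″ j″ refl refl p″)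
            i<i′ i′<i″ j′<j″ j″<j f
    with t , j≤t , g , ¬g ← topOfColumn (isBoard F) f =
    avoids V (proj₂ (topBorder F g ¬g)) (contains P V
      ((i , j) ∷ (i′ , j′) ∷ (i″ , j″) ∷ [])
      ((i<i′ ∷ <-trans i<i′ i′<i″ ∷ []) ∷ (i′<i″ ∷ []) ∷ [] ∷ [])
      ((p , m<n⇒m<1+n (<-trans i<i′ i′<i″) , s≤s j≤t)
        ∷ (p′ , m<n⇒m<1+n i′<i″ , m<n⇒m<1+n (<-≤-trans (<-trans j′<j″ j″<j) j≤t))
        ∷ (p″ , ≤-refl , m<n⇒m<1+n (<-≤-trans j″<j j≤t)) ∷ [])
      (λ _ mono → orderIsomorphic312 (mono (there (here refl)) j′<j″)
                                     (mono (there (there (here refl))) j″<j)))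
    where
    V : Vertex
    V = suc (toℕ i″) , suc t

-- Chains, increasing sequences and the values S(P,V)

module _ {P : Squares m} where

  private
    -- Chains open at the last marker and lists at the first: the list accumulates the markers
    -- already moved, and the chain keeps those still left of and below (i , j).
    prepend : ∀ {V i j c} → Chain (On P) (toℕ i) (toℕ j) n →
              IsIncreasingSequence P V ((i , j) ∷ c) →
              ∃ λ c′ → IsIncreasingSequence P V c′ × length c′ ≡ n + suc (length c)
    prepend [] inc = _ , inc , refl
    prepend {n = suc n} (snoc (on i′ j′ refl refl p) i′<i j′<j ch)
            (l , (q , i<a , j<b) ∷ ps)
      with c′ , inc , eq ← prepend ch
             ((i′<i , j′<j) ∷ l , (p , <-trans i′<i i<a , <-trans j′<j j<b) ∷ (q , i<a , j<b) ∷ ps)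
      = c′ , inc , trans eq (+-suc n _)

    -- The same transfer backwards, with the chain as accumulator.
    append : ∀ {i j c} → Linked _↗_ ((i , j) ∷ c) →
             All (λ s → s ∈ P × s ∈R (a , b)) ((i , j) ∷ c) →
             Chain (On P) (toℕ i) (toℕ j) n → Chain (On P) a b (n + suc (length c))
    append {n = n} {i} {j} [-] ((p , i<a , j<b) ∷ []) ch =
      subst (Chain (On P) _ _) (+-comm 1 n) (snoc (on i j refl refl p) i<a j<b ch)
    append {n = n} {i} {j} ((i<i′ , j<j′) ∷ l) ((p , _) ∷ ps) ch =
      subst (Chain (On P) _ _) (sym (+-suc n _))
        (append l ps (snoc (on i j refl refl p) i<i′ j<j′ ch))

  chain⇒sequence : Chain (On P) a b n →
                   ∃ λ c → IsIncreasingSequence P (a , b) c × length c ≡ n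
  chain⇒sequence [] = [] , ([] , []) , refl
  chain⇒sequence (snoc {n} (on i j refl refl p) i<a j<b ch)
    with c , inc , eq ← prepend ch ([-] , (p , i<a , j<b) ∷ []) =
    c , inc , trans eq (+-comm n 1)

  sequence⇒chain : ∀ c → IsIncreasingSequence P (a , b) c → Chain (On P) a b (length c)
  sequence⇒chain []      _        = []
  sequence⇒chain (_ ∷ _) (l , ps) = append l ps []

  chain⇒≤S : Chain (On P) a b n → n ≤ S P (a , b)
  chain⇒≤S {a} {b} ch with c , inc , refl ← chain⇒sequence ch =
    proj₂ (proj₂ (maximalLength P (a , b))) c inc

  ≤S⇒chain : n ≤ S P (a , b) → Chain (On P) a b n
  ≤S⇒chain {n = n} {a = a} {b} n≤S with c , inc , eq ← proj₁ (proj₂ (maximalLength P (a , b))) =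
    shorten (subst (n ≤_) (sym eq) n≤S) (sequence⇒chain c inc)

S≡⇒≈ : {P Q : Squares m} → S P (a , b) ≡ S Q (a , b) → On P ≈[ a , b ] On Q
S≡⇒≈ eq = (λ ch → ≤S⇒chain (subst (_ ≤_) eq (chain⇒≤S ch)))
        , (λ ch → ≤S⇒chain (subst (_ ≤_) (sym eq) (chain⇒≤S ch)))

-- Recovering the placement from its border sequence

sameOnBorder : (F : FerrersBoard m) {P Q : Squares m} → Sequence F P ≡ Sequence F Q →
               SameOnBorder (On (FerrersBoard.squares F)) (On P) (On Q)
sameOnBorder F {P} {Q} eq = record
  { right = λ f ¬f → let v , v′ = rightBorder F f ¬f in same v , same v′
  ; top   = λ f ¬f → let v , v′ = topBorder F f ¬f in same v , same v′
  }
  where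
  open FerrersBoard F
  same : ∀ {a b} → OnRightUpBorder squares (a , b) → On P ≈[ a , b ] On Q
  same v = let a≤m , b≤m = border-bounded {X = squares} v in
    S≡⇒≈ {P = P} {Q} (map-≡⇒≗ eq (∈-filter⁺ (onRightUpBorder? squares)
      (∈-cartesianProduct⁺ (∈-upTo⁺ a≤m) (∈-downFrom⁺ b≤m)) v))

determined : (F : FerrersBoard m) (τ : List ℕ) →
  (τ ≡ 2 ∷ 3 ∷ 1 ∷ []) ⊎ (τ ≡ 3 ∷ 1 ∷ 2 ∷ []) →
  ∀ (P Q : Squares m) → FullAvoiding F τ P → FullAvoiding F τ Q →
  Sequence F P ≡ Sequence F Q → On P ⇒ On Q
determined F _ (inj₁ refl) P Q avP avQ eq = determined231 (isBoard F)
  (isFullPlacement P.isFull) (avoids231 F P.avoids)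
  (isFullPlacement Q.isFull) (avoids231 F Q.avoids) (sameOnBorder F eq)
  where
  module P = FullAvoiding avP
  module Q = FullAvoiding avQ
determined F _ (inj₂ refl) P Q avP avQ eq = determined312 (isBoard F)
  (isFullPlacement P.isFull) (avoids312 F P.avoids)
  (isFullPlacement Q.isFull) (avoids312 F Q.avoids) (sameOnBorder F eq)
  where
  module P = FullAvoiding avP
  module Q = FullAvoiding avQ

theorem1 : ∀ {m : ℕ} (F : FerrersBoard m) (τ : List ℕ) →
    (τ ≡ 2 ∷ 3 ∷ 1 ∷ []) ⊎ (τ ≡ 3 ∷ 1 ∷ 2 ∷ []) →
    ∀ (P Q : Squares m) → FullAvoiding F τ P → FullAvoiding F τ Q →
    Sequence F P ≡ Sequence F Q → P ≡ Q
theorem1 F τ τ≡ P Q avP avQ eq =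
  on-injective (determined F τ τ≡ P Q avP avQ eq) (determined F τ τ≡ Q P avQ avP (sym eq))
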